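{- Up to collinearity there are exactly 7 generalised nice sets $T\subseteq X_0$ such that $T\cap X$ is not a generalised nice set: every such $T$ is collinear to exactly one of the following sets: (1) $\{\{0,0\}\}\cup\{\{0,l\},\{1,l\}: l\in\{1,2,5\}\}$ (7 elements); (2) $\{\{0,0\}\}\cup\{\{0,l\},\{1,l\}: l\in\{1,2,5\}\}\cup\{\{2,2\},\{2,5\},\{5,5\}\}$ (10 elements); (3) $\{\{0,0\}\}\cup\{\{0,l\},\{1,l\}: l\in\{1,2,5\}\}\cup\{\{0,3\},\{0,6\},\{1,3\},\{1,6\}\}$ (11 elements); (4) $\{\{0,0\}\}\cup\{\{0,l\},\{1,l\}: l=1,\dots,7\}$ (15 elements); (5) $\{\{0,0\}\}\cup\{\{0,l\},\{1,l\}: l=1,\dots,7\}\cup\{\{2,3\},\{5,3\},\{2,6\},\{5,6\}\}$ (19 elements); (6) $X_0\setminus\{\{k,l\}: k,l\in\{3,4,6,7\}\}$, where $k=l$ is allowed (26 elements); (7) $X_0$ (36 elements).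
   Context: Let $I=\{1,\dots,7\}$ and $I_0=I\cup\{0\}$. The Fano plane on $I$ has the seven lines $\{1,2,5\},\{5,6,7\},\{1,4,7\},\{1,3,6\},\{2,4,6\},\{2,3,7\},\{3,4,5\}$. For distinct $i,j\in I$, $i*j$ is the third point of the unique line containing $i$ and $j$. The operation is extended to $I_0$ by $0*i=i*0=i$ and $i*i=0$ for all $i\in I_0$. A collineation is a bijection $\sigma:I_0\to I_0$ with $\sigma(i*j)=\sigma(i)*\sigma(j)$ for all $i,j\in I_0$. Let $X_0$ be the set of unordered pairs $\{i,j\}$ with $i,j\in I_0$, where $i=j$ is allowed, and $X=\{\{i,j\}:i,j\in I,\ i\neq j\}$. A collineation $\sigma$ acts on $X_0$ by $\tilde\sigma(\{i,j\})=\{\sigma(i),\sigma(j)\}$, hence on subsets; subsets $T,T'\subseteq X_0$ are collinear if $\tilde\sigma(T)=T'$ for some collineation $\sigma$. For $i,j,k\in I_0$ let $P_{\{i,j,k\}}=\{\{i,j\},\{j,k\},\{k,i\},\{i,j*k\},\{j,k*i\},\{k,i*j\}\}\subseteq X_0$. A subset $T\subseteq X_0$ is a generalised nice set if for all $i,j,k\in I_0$, $\{i,j\}\in T$ and $\{i*j,k\}\in T$ imply $P_{\{i,j,k\}}\subseteq T$. -}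

module Defs where

open import Data.Nat using (ℕ)
open import Data.Fin using (Fin; #_; _≟_)
open import Data.Fin.Permutation using (Permutation′; _⟨$⟩ʳ_)
open import Data.Bool using (Bool; true; false; _∧_; _∨_; not; if_then_else_)
open import Data.List using (List; []; _∷_)
open import Data.Bool.ListAction using (any)
open import Data.Product using (_×_; _,_; Σ; ∃)
open import Data.Sum using (_⊎_)
open import Relation.Nullary.Decidable using (⌊_⌋)
open import Relation.Binary.PropositionalEquality using (_≡_)

I₀ : Set
I₀ = Fin 8

infix 8 _==_
_==_ : I₀ → I₀ → Bool
i == j = ⌊ i ≟ j ⌋

-- The seven lines of the Fano plane.
lines : List (I₀ × I₀ × I₀)
lines = (# 1 , # 2 , # 5) ∷ (# 5 , # 6 , # 7) ∷ (# 1 , # 4 , # 7) ∷ (# 1 , # 3 , # 6)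
      ∷ (# 2 , # 4 , # 6) ∷ (# 2 , # 3 , # 7) ∷ (# 3 , # 4 , # 5) ∷ []

-- third point of the line through distinct i, j ∈ I (result for other inputs irrelevant)
third : I₀ → I₀ → I₀
third i j = go lines
  where
  pair : I₀ → I₀ → Bool
  pair a b = (i == a ∧ j == b) ∨ (i == b ∧ j == a)
  go : List (I₀ × I₀ × I₀) → I₀
  go [] = # 0
  go ((a , b , c) ∷ ls) =
    if pair a b then c else if pair a c then b else if pair b c then a else go ls

infixl 7 _*_
_*_ : I₀ → I₀ → I₀
i * j = if i == # 0 then j else if j == # 0 then i else if i == j then # 0 else third i j

record Collineation : Set where
  field
    perm : Permutation′ 8
    hom  : ∀ i j → perm ⟨$⟩ʳ (i * j) ≡ (perm ⟨$⟩ʳ i) * (perm ⟨$⟩ʳ j)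
open Collineation public

-- A subset T ⊆ X₀ (unordered pairs {i,j}, i = j allowed) is represented by a
-- Bool-valued relation on I₀; {i,j} ∈ T means  T i j ≡ true.  Such a relation
-- represents a set of unordered pairs exactly when it is symmetric.
Rel₀ : Set
Rel₀ = I₀ → I₀ → Bool

Symmetric : Rel₀ → Set
Symmetric T = ∀ i j → T i j ≡ T j i

_∈ₚ_ : I₀ × I₀ → Rel₀ → Set
(i , j) ∈ₚ T = T i j ≡ true

SamePair : I₀ × I₀ → I₀ × I₀ → Set
SamePair (a , b) (c , d) = (a ≡ c × b ≡ d) ⊎ (a ≡ d × b ≡ c)

IsImage : Collineation → Rel₀ → Rel₀ → Set
IsImage σ T T' = ∀ a b → ((a , b) ∈ₚ T' → ∃ λ i → ∃ λ j → (i , j) ∈ₚ T × SamePair (perm σ ⟨$⟩ʳ i , perm σ ⟨$⟩ʳ j) (a , b))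
                       × ((∃ λ i → ∃ λ j → (i , j) ∈ₚ T × SamePair (perm σ ⟨$⟩ʳ i , perm σ ⟨$⟩ʳ j) (a , b)) → (a , b) ∈ₚ T')

Collinear : Rel₀ → Rel₀ → Set
Collinear T T' = Σ Collineation λ σ → IsImage σ T T'

PSub : I₀ → I₀ → I₀ → Rel₀ → Set
PSub i j k T = (i , j) ∈ₚ T × (j , k) ∈ₚ T × (k , i) ∈ₚ T
             × (i , j * k) ∈ₚ T × (j , k * i) ∈ₚ T × (k , i * j) ∈ₚ T

GenNice : Rel₀ → Set
GenNice T = ∀ i j k → (i , j) ∈ₚ T → (i * j , k) ∈ₚ T → PSub i j k T

∩X : Rel₀ → Rel₀
∩X T i j = T i j ∧ not (i == # 0) ∧ not (j == # 0) ∧ not (i == j)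

fromList : List (I₀ × I₀) → Rel₀
fromList ps i j = any (λ { (a , b) → (i == a ∧ j == b) ∨ (i == b ∧ j == a) }) ps

base : List (I₀ × I₀)
base = (# 0 , # 0) ∷ (# 0 , # 1) ∷ (# 0 , # 2) ∷ (# 0 , # 5)
     ∷ (# 1 , # 1) ∷ (# 1 , # 2) ∷ (# 1 , # 5) ∷ []

full : List (I₀ × I₀)
full = (# 0 , # 0) ∷ (# 0 , # 1) ∷ (# 0 , # 2) ∷ (# 0 , # 3) ∷ (# 0 , # 4)
     ∷ (# 0 , # 5) ∷ (# 0 , # 6) ∷ (# 0 , # 7)
     ∷ (# 1 , # 1) ∷ (# 1 , # 2) ∷ (# 1 , # 3) ∷ (# 1 , # 4)
     ∷ (# 1 , # 5) ∷ (# 1 , # 6) ∷ (# 1 , # 7) ∷ []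

open import Data.List using (_++_)

inK : I₀ → Bool
inK k = k == # 3 ∨ k == # 4 ∨ k == # 6 ∨ k == # 7

S : Fin 7 → Rel₀
S Fin.zero = fromList base
S (Fin.suc Fin.zero) = fromList (base ++ ((# 2 , # 2) ∷ (# 2 , # 5) ∷ (# 5 , # 5) ∷ []))
S (Fin.suc (Fin.suc Fin.zero)) =
  fromList (base ++ ((# 0 , # 3) ∷ (# 0 , # 6) ∷ (# 1 , # 3) ∷ (# 1 , # 6) ∷ []))
S (Fin.suc (Fin.suc (Fin.suc Fin.zero))) = fromList full
S (Fin.suc (Fin.suc (Fin.suc (Fin.suc Fin.zero)))) =
  fromList (full ++ ((# 2 , # 3) ∷ (# 5 , # 3) ∷ (# 2 , # 6) ∷ (# 5 , # 6) ∷ []))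
S (Fin.suc (Fin.suc (Fin.suc (Fin.suc (Fin.suc Fin.zero))))) i j = not (inK i ∧ inK j)
S (Fin.suc (Fin.suc (Fin.suc (Fin.suc (Fin.suc (Fin.suc Fin.zero)))))) i j = true

{-# OPTIONS --safe #-}
module Submission where

-- If T is generalised nice and T ∩ X is not, then some violation of niceness in X
-- must be degenerate: T contains {i , j} and {i * j , i} for distinct i , j ∈ I.
-- A collineation moves (i , j) to (1 , 2), and closing {1 , 2} , {5 , 1} under the
-- niceness rule yields S 0 ⊆ T.  Moreover, adding any further pair to S r forces,
-- by the same rule, a collinear copy of a later S r′; so, climbing from S 0, T
-- ends up collinear to some S r.  The index r is unique since the S r have
-- different cardinalities.

open import Defs
import Data.Nat.Properties as ℕ
open import Algebra.Properties.CommutativeMonoid.Sum ℕ.+-0-commutativeMonoid using (sum; sum-cong-≗; sum-permute)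
open import Data.Bool using (Bool; true; false; _∧_; if_then_else_)
import Data.Bool.Properties as Bool
open import Data.Empty using (⊥-elim)
open import Data.Fin using (Fin; zero; suc; #_; _<_; _>_)
open import Data.Fin.Induction using (>-wellFounded)
open import Data.Fin.Permutation as Perm using (permutation; flip; inverseˡ; inverseʳ; _∘ₚ_; _⟨$⟩ʳ_; _⟨$⟩ˡ_)
open import Data.Fin.Properties using (_≟_; _<?_; all?; any?)
open import Data.List using (List; []; _∷_; foldl)
open import Data.List.Relation.Unary.All using (All; []; _∷_)
open import Data.List.Relation.Unary.Any as Any using (Any)
open import Data.Nat using (ℕ)
open import Data.Product using (_×_; _,_; Σ; ∃; proj₁; proj₂)
open import Data.Sum using (_⊎_; inj₁; inj₂; [_,_]′)
open import Data.Vec using (Vec; lookup; tabulate; _∷_; []; _[_]%=_; _[_]≔_)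
open import Data.Vec.Properties using (lookup∘updateAt; lookup∘updateAt′; lookup∘tabulate)
open import Function using (_∘_; case_of_; mk⇔)
open import Induction.WellFounded using (Acc; acc)
open import Relation.Nullary using (¬_; Dec; yes; no; ¬?)
open import Relation.Nullary.Decidable using (from-yes; True; toWitness; decidable-stable; _×-dec_; _⊎-dec_; _→-dec_)
open import Relation.Binary.PropositionalEquality using (_≡_; refl; sym; trans; cong; cong₂; subst; subst₂; module ≡-Reasoning)

-- Decidability of inclusion and niceness.

infix 4 _⊆_

_⊆_ : Rel₀ → Rel₀ → Set
A ⊆ B = ∀ i j → (i , j) ∈ₚ A → (i , j) ∈ₚ B

_∈ₚ?_ : ∀ p T → Dec (p ∈ₚ T)
(i , j) ∈ₚ? T = T i j Bool.≟ true

_⊆?_ : ∀ A B → Dec (A ⊆ B)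
A ⊆? B = all? λ i → all? λ j → ((i , j) ∈ₚ? A) →-dec ((i , j) ∈ₚ? B)

PSub? : ∀ i j k T → Dec (PSub i j k T)
PSub? i j k T = ((i , j) ∈ₚ? T) ×-dec ((j , k) ∈ₚ? T) ×-dec ((k , i) ∈ₚ? T)
  ×-dec ((i , j * k) ∈ₚ? T) ×-dec ((j , k * i) ∈ₚ? T) ×-dec ((k , i * j) ∈ₚ? T)

GenNice? : ∀ T → Dec (GenNice T)
GenNice? T = all? λ i → all? λ j → all? λ k →
  ((i , j) ∈ₚ? T) →-dec (((i * j , k) ∈ₚ? T) →-dec PSub? i j k T)

listed : ∀ r → GenNice (S r) × ¬ GenNice (∩X (S r))
listed = from-yes (all? λ r → GenNice? (S r) ×-dec ¬? (GenNice? (∩X (S r))))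

-- Collineations of the Fano plane.

-- Bijectivity is phrased through unique preimages, so that finite search decides it and the inverse
-- can be read off.
Automorphic : (I₀ → I₀) → Set
Automorphic f = (∀ y → ∃ λ x → f x ≡ y × (∀ x′ → f x′ ≡ y → x′ ≡ x))
              × (∀ i j → f (i * j) ≡ f i * f j)

automorphic? : ∀ f → Dec (Automorphic f)
automorphic? f =
  (all? λ y → any? λ x → (f x ≟ y) ×-dec (all? λ x′ → (f x′ ≟ y) →-dec (x′ ≟ x)))
  ×-dec (all? λ i → all? λ j → f (i * j) ≟ f i * f j)

collineation : ∀ f → Automorphic f → Collineation
collineation f (bij , hom-f) = record
  { perm = permutation f (proj₁ ∘ bij) (proj₁ ∘ proj₂ ∘ bij)
                       (λ x → sym (proj₂ (proj₂ (bij (f x))) x refl))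
  ; hom  = hom-f
  }

-- The only candidate for a collineation sending 1, 2, 3 to a, b, c.
frame : I₀ → I₀ → I₀ → I₀ → I₀
frame a b c = lookup (# 0 ∷ a ∷ b ∷ c ∷ a * b * c ∷ a * b ∷ a * c ∷ b * c ∷ [])

frameCollineation : ∀ a b c {_ : True (automorphic? (frame a b c))} → Collineation
frameCollineation a b c {p} = collineation (frame a b c) (toWitness p)

-- With this form `∩X T i j` is definitionally `T i j ∧ X i j`.
X : Rel₀
X = ∩X λ _ _ → true

-- Any `k` off the line through `i` and `j` works: collineations act transitively on ordered
-- triangles.
extendToFrame : ∀ i j → (i , j) ∈ₚ X → ∃ λ k → Automorphic (frame i j k)
extendToFrame = from-yes (all? λ i → all? λ j →
  ((i , j) ∈ₚ? X) →-dec any? λ k → automorphic? (frame i j k))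

-- The second premise excludes `k = i * j`. So if `k` is neither `i` nor `j`, it lies off their
-- line, and all six pairs consist of distinct nonzero points.
triangle : ∀ i j k → (i , j) ∈ₚ X → (i * j , k) ∈ₚ X → k ≡ i ⊎ k ≡ j ⊎ PSub i j k X
triangle = from-yes (all? λ i → all? λ j → all? λ k →
  ((i , j) ∈ₚ? X) →-dec (((i * j , k) ∈ₚ? X) →-dec
    ((k ≟ i) ⊎-dec (k ≟ j) ⊎-dec PSub? i j k X)))

-- Closing a set under the niceness rule.

-- Vectors keep the result of an insertion as data; updating a function would nest one more case
-- distinction each time.
Matrix : Set
Matrix = Vec (Vec Bool 8) 8

entries : Matrix → Rel₀
entries M i = lookup (lookup M i)

toMatrix : Rel₀ → Matrix
toMatrix T = tabulate λ i → tabulate (T i)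

insert : Matrix → I₀ × I₀ → Matrix
insert M (i , j) = M [ i ]%= (_[ j ]≔ true)

insertSym : Matrix → I₀ × I₀ → Matrix
insertSym M (i , j) = insert (insert M (i , j)) (j , i)

triangleList : I₀ → I₀ → I₀ → List (I₀ × I₀)
triangleList i j k = (i , j) ∷ (j , k) ∷ (k , i) ∷ (i , j * k) ∷ (j , k * i) ∷ (k , i * j) ∷ []

apply : Matrix → I₀ × I₀ × I₀ → Matrix
apply M (i , j , k) = if entries M i j ∧ entries M (i * j) k
  then foldl insertSym M (triangleList i j k) else M

saturate : List (I₀ × I₀ × I₀) → Matrix → Matrix
saturate []       M = M
saturate (t ∷ ts) M = saturate ts (apply M t)

insert-sound : ∀ {T} M p → p ∈ₚ T → entries M ⊆ T → entries (insert M p) ⊆ T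
insert-sound M (i , j) ij∈T M⊆T a b p with a ≟ i
... | no a≢i = M⊆T a b (trans (sym (cong (λ row → lookup row b) (lookup∘updateAt′ a i a≢i M))) p)
... | yes refl with b ≟ j
...   | yes refl = ij∈T
...   | no b≢j = M⊆T a b (trans (sym (trans
          (cong (λ row → lookup row b) (lookup∘updateAt a M))
          (lookup∘updateAt′ b j b≢j (lookup M a)))) p)

insertSym-sound : ∀ {T} M p → Symmetric T → p ∈ₚ T → entries M ⊆ T → entries (insertSym M p) ⊆ T
insertSym-sound M (i , j) T-sym ij∈T M⊆T =
  insert-sound (insert M (i , j)) (j , i) (trans (T-sym j i) ij∈T) (insert-sound M (i , j) ij∈T M⊆T)

insertAll-sound : ∀ {T} M {ps} → Symmetric T → All (_∈ₚ T) ps →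
  entries M ⊆ T → entries (foldl insertSym M ps) ⊆ T
insertAll-sound M T-sym []           M⊆T = M⊆T
insertAll-sound M T-sym (p∈T ∷ ps⊆T) M⊆T =
  insertAll-sound _ T-sym ps⊆T (insertSym-sound M _ T-sym p∈T M⊆T)

apply-sound : ∀ {T} M t → Symmetric T → GenNice T → entries M ⊆ T → entries (apply M t) ⊆ T
apply-sound M (i , j , k) T-sym nice M⊆T
  with entries M i j in ij | entries M (i * j) k in ijk
... | false | _     = M⊆T
... | true  | false = M⊆T
... | true  | true  with nice i j k (M⊆T i j ij) (M⊆T (i * j) k ijk)
... | p₁ , p₂ , p₃ , p₄ , p₅ , p₆ =
  insertAll-sound M T-sym (p₁ ∷ p₂ ∷ p₃ ∷ p₄ ∷ p₅ ∷ p₆ ∷ []) M⊆T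

-- Niceness forces every inserted pair into `T`, so one computation on `M` speaks about every
-- symmetric nice `T` containing it.
saturate-sound : ∀ {T} ts M → Symmetric T → GenNice T →
  entries M ⊆ T → entries (saturate ts M) ⊆ T
saturate-sound []       M T-sym nice M⊆T = M⊆T
saturate-sound (t ∷ ts) M T-sym nice M⊆T =
  saturate-sound ts (apply M t) T-sym nice (apply-sound M t T-sym nice M⊆T)

toMatrix-sound : ∀ A → entries (toMatrix A) ⊆ A
toMatrix-sound A i j p = trans (sym entry) p
  where
  entry : entries (toMatrix A) i j ≡ A i j
  entry = trans (cong (λ row → lookup row j) (lookup∘tabulate (λ i → tabulate (A i)) i))
                (lookup∘tabulate (A i) j)

-- Group operations on collineations, and pullbacks.

idCollineation : Collineation
idCollineation = record { perm = Perm.id ; hom = λ _ _ → refl }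

_∘ᶜ_ : Collineation → Collineation → Collineation
σ ∘ᶜ τ = record
  { perm = perm τ ∘ₚ perm σ
  ; hom  = λ i j → trans (cong (perm σ ⟨$⟩ʳ_) (hom τ i j)) (hom σ (perm τ ⟨$⟩ʳ i) (perm τ ⟨$⟩ʳ j))
  }

_⁻¹ : Collineation → Collineation
σ ⁻¹ = record { perm = flip (perm σ) ; hom = λ i j → begin
  perm σ ⟨$⟩ˡ (i * j)
    ≡⟨ cong₂ (λ x y → perm σ ⟨$⟩ˡ (x * y)) (inverseʳ (perm σ)) (inverseʳ (perm σ)) ⟨
  perm σ ⟨$⟩ˡ ((perm σ ⟨$⟩ʳ (perm σ ⟨$⟩ˡ i)) * (perm σ ⟨$⟩ʳ (perm σ ⟨$⟩ˡ j)))
    ≡⟨ cong (perm σ ⟨$⟩ˡ_) (hom σ (perm σ ⟨$⟩ˡ i) (perm σ ⟨$⟩ˡ j)) ⟨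
  perm σ ⟨$⟩ˡ (perm σ ⟨$⟩ʳ ((perm σ ⟨$⟩ˡ i) * (perm σ ⟨$⟩ˡ j)))
    ≡⟨ inverseˡ (perm σ) ⟩
  (perm σ ⟨$⟩ˡ i) * (perm σ ⟨$⟩ˡ j) ∎ }
  where open ≡-Reasoning

pullback : Collineation → Rel₀ → Rel₀
pullback σ T i j = T (perm σ ⟨$⟩ʳ i) (perm σ ⟨$⟩ʳ j)

pullback-GenNice : ∀ σ {T} → GenNice T → GenNice (pullback σ T)
pullback-GenNice σ {T} nice i j k ij ijk =
  let f = perm σ ⟨$⟩ʳ_
      p₁ , p₂ , p₃ , p₄ , p₅ , p₆ =
        nice (f i) (f j) (f k) ij (subst (λ x → T x (f k) ≡ true) (hom σ i j) ijk)
  in p₁ , p₂ , p₃ , fold i j k p₄ , fold j k i p₅ , fold k i j p₆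
  where
  fold : ∀ x a b → T (perm σ ⟨$⟩ʳ x) ((perm σ ⟨$⟩ʳ a) * (perm σ ⟨$⟩ʳ b)) ≡ true →
         T (perm σ ⟨$⟩ʳ x) (perm σ ⟨$⟩ʳ (a * b)) ≡ true
  fold x a b = subst (λ y → T (perm σ ⟨$⟩ʳ x) y ≡ true) (sym (hom σ a b))

-- The two inclusions say that `σ` carries `T′` onto `T`, so its inverse is the witness.
pullback⇒Collinear : ∀ σ {T T′} → Symmetric T → pullback σ T ⊆ T′ → T′ ⊆ pullback σ T → Collinear T T′
pullback⇒Collinear σ {T} {T′} T-sym pull⊆T′ T′⊆pull = σ ⁻¹ , λ a b →
  (λ ab∈T′ → _ , _ , T′⊆pull a b ab∈T′ , inj₁ (inverseˡ (perm σ) , inverseˡ (perm σ))) ,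
  λ { (i , j , ij∈T , inj₁ (refl , refl)) → push i j ij∈T
    ; (i , j , ij∈T , inj₂ (refl , refl)) → push j i (trans (T-sym j i) ij∈T) }
  where
  push : ∀ i j → (i , j) ∈ₚ T → (perm σ ⟨$⟩ˡ i , perm σ ⟨$⟩ˡ j) ∈ₚ T′
  push i j p = pull⊆T′ _ _
    (subst₂ (λ x y → T x y ≡ true) (sym (inverseʳ (perm σ))) (sym (inverseʳ (perm σ))) p)

-- By injectivity of `σ` a preimage of the image pair is `(i , j)` or `(j , i)`; symmetry of `T`
-- settles the latter.
Collinear⇒pullback : ∀ {T T′} → Symmetric T → ((σ , _) : Collinear T T′) →
  ∀ i j → T i j ≡ pullback σ T′ i j
Collinear⇒pullback {T} {T′} T-sym (σ , image) i j = Bool.⇔→≡ (mk⇔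
  (λ ij∈T → proj₂ (image _ _) (i , j , ij∈T , inj₁ (refl , refl)))
  (λ p → preimage (proj₁ (image _ _) p)))
  where
  injective : ∀ {x y} → perm σ ⟨$⟩ʳ x ≡ perm σ ⟨$⟩ʳ y → x ≡ y
  injective eq = trans (sym (inverseˡ (perm σ))) (trans (cong (perm σ ⟨$⟩ˡ_) eq) (inverseˡ (perm σ)))
  preimage : (∃ λ a → ∃ λ b → (a , b) ∈ₚ T
               × SamePair (perm σ ⟨$⟩ʳ a , perm σ ⟨$⟩ʳ b) (perm σ ⟨$⟩ʳ i , perm σ ⟨$⟩ʳ j)) →
             (i , j) ∈ₚ T
  preimage (a , b , ab∈T , inj₁ (p , q)) with injective p | injective q
  ... | refl | refl = ab∈T
  preimage (a , b , ab∈T , inj₂ (p , q)) with injective p | injective q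
  ... | refl | refl = trans (T-sym i j) ab∈T

-- Cardinality as an invariant.

-- Counts ordered pairs, so {i , j} with i ≢ j contributes 2.
card : Rel₀ → ℕ
card T = sum λ i → sum λ j → if T i j then 1 else 0

-- A collineation permutes columns and rows of the Boolean table, and `sum-permute` undoes these one
-- after the other.
card-Collinear : ∀ {T T′} → Symmetric T → Collinear T T′ → card T ≡ card T′
card-Collinear {T} {T′} T-sym c@(σ , _) = begin
  card T
    ≡⟨ sum-cong-≗ (λ i → sum-cong-≗ λ j → cong (if_then 1 else 0) (Collinear⇒pullback T-sym c i j)) ⟩
  card (pullback σ T′)
    ≡⟨ sum-cong-≗ (λ i → sum-permute (λ j → if T′ (perm σ ⟨$⟩ʳ i) j then 1 else 0) (perm σ)) ⟨
  (sum λ i → sum λ j → if T′ (perm σ ⟨$⟩ʳ i) j then 1 else 0)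
    ≡⟨ sum-permute (λ i → sum λ j → if T′ i j then 1 else 0) (perm σ) ⟨
  card T′ ∎
  where open ≡-Reasoning

-- The seven values are 12, 16, 20, 28, 36, 48 and 64.
card-S-injective : ∀ r r′ → card (S r) ≡ card (S r′) → r ≡ r′
card-S-injective = from-yes (all? λ r → all? λ r′ → (card (S r) ℕ.≟ card (S r′)) →-dec (r ≟ r′))

-- Climbing through the seven sets.

-- Found by a greedy search: applying the niceness rule once at each of these
-- triples, in this order, is enough for S₀⊆saturate-seed and
-- enlarge-containsSuccessor.  Soundness holds for any list.  Opaque because
-- saturate moves M blows up exponentially when M is not closed.
opaque
  moves : List (I₀ × I₀ × I₀)
  moves =
    (# 4 , # 7 , # 5) ∷ (# 7 , # 3 , # 1) ∷ (# 2 , # 1 , # 3) ∷ (# 1 , # 5 , # 3) ∷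
    (# 1 , # 0 , # 4) ∷ (# 2 , # 1 , # 7) ∷ (# 5 , # 1 , # 7) ∷ (# 1 , # 1 , # 7) ∷
    (# 1 , # 2 , # 6) ∷ (# 5 , # 1 , # 6) ∷ (# 3 , # 6 , # 1) ∷ (# 3 , # 3 , # 5) ∷
    (# 3 , # 4 , # 1) ∷ (# 1 , # 4 , # 7) ∷ (# 4 , # 4 , # 2) ∷ (# 6 , # 4 , # 1) ∷
    (# 1 , # 5 , # 4) ∷ (# 1 , # 0 , # 6) ∷ (# 6 , # 6 , # 5) ∷ (# 7 , # 6 , # 1) ∷
    (# 5 , # 6 , # 3) ∷ (# 6 , # 3 , # 1) ∷ (# 0 , # 1 , # 7) ∷ (# 1 , # 1 , # 4) ∷
    (# 5 , # 5 , # 3) ∷ (# 2 , # 1 , # 4) ∷ (# 2 , # 7 , # 5) ∷ (# 2 , # 5 , # 1) ∷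
    (# 1 , # 5 , # 2) ∷ (# 5 , # 2 , # 6) ∷ (# 2 , # 5 , # 3) ∷ (# 7 , # 7 , # 2) ∷
    (# 5 , # 1 , # 7) ∷ (# 3 , # 7 , # 1) ∷ (# 0 , # 1 , # 7) ∷ (# 6 , # 7 , # 4) ∷
    (# 7 , # 4 , # 1) ∷ (# 1 , # 1 , # 6) ∷ (# 0 , # 1 , # 3) ∷ (# 1 , # 1 , # 3) ∷
    (# 1 , # 5 , # 1) ∷ (# 1 , # 2 , # 0) ∷ (# 2 , # 1 , # 5) ∷ (# 1 , # 3 , # 5) ∷
    (# 6 , # 1 , # 1) ∷ (# 0 , # 5 , # 0) ∷ []

-- An entry (r′ , σ) stands for the set σ(S r′).
successors : Fin 7 → List (Fin 7 × Collineation)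
successors zero =
  (# 1 , frameCollineation (# 1) (# 2) (# 3)) ∷
  (# 2 , frameCollineation (# 1) (# 2) (# 3)) ∷
  (# 2 , frameCollineation (# 1) (# 2) (# 4)) ∷ []
successors (suc zero) =
  (# 2 , frameCollineation (# 1) (# 2) (# 3)) ∷
  (# 2 , frameCollineation (# 1) (# 2) (# 4)) ∷ []
successors (suc (suc zero)) =
  (# 3 , frameCollineation (# 1) (# 2) (# 3)) ∷ []
successors (suc (suc (suc zero))) =
  (# 4 , frameCollineation (# 1) (# 2) (# 3)) ∷
  (# 4 , frameCollineation (# 1) (# 2) (# 4)) ∷
  (# 4 , frameCollineation (# 1) (# 3) (# 4)) ∷ []
successors (suc (suc (suc (suc zero)))) =
  (# 5 , frameCollineation (# 1) (# 2) (# 3)) ∷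
  (# 5 , frameCollineation (# 1) (# 3) (# 2)) ∷ []
successors (suc (suc (suc (suc (suc zero))))) =
  (# 6 , frameCollineation (# 1) (# 2) (# 3)) ∷ []
successors (suc (suc (suc (suc (suc (suc zero)))))) = []

ContainsSuccessor : Fin 7 → Rel₀ → Set
ContainsSuccessor r T = Any (λ (r′ , σ) → r < r′ × S r′ ⊆ pullback σ T) (successors r)

containsSuccessor? : ∀ r M → Dec (ContainsSuccessor r (entries M))
containsSuccessor? r M =
  Any.any? (λ (r′ , σ) → (r <? r′) ×-dec (S r′ ⊆? pullback σ (entries M))) (successors r)

enlarge : Fin 7 → I₀ × I₀ → Matrix
enlarge r p = saturate moves (insertSym (toMatrix (S r)) p)

opaque
  unfolding moves

  -- One added pair at a time suffices: a nice set strictly larger than `S r` contains such a pair,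
  -- hence the whole enlarged set.
  enlarge-containsSuccessor : ∀ r i j → (i , j) ∈ₚ S r ⊎ ContainsSuccessor r (entries (enlarge r (i , j)))
  enlarge-containsSuccessor = from-yes (all? λ r → all? λ i → all? λ j →
    ((i , j) ∈ₚ? S r) ⊎-dec containsSuccessor? r (enlarge r (i , j)))

enlarge-sound : ∀ r p {T} → Symmetric T → GenNice T → S r ⊆ T → p ∈ₚ T → entries (enlarge r p) ⊆ T
enlarge-sound r p T-sym nice Sr⊆T p∈T =
  saturate-sound moves (insertSym (toMatrix (S r)) p) T-sym nice
    (insertSym-sound (toMatrix (S r)) p T-sym p∈T
      λ a b ab∈ → Sr⊆T a b (toMatrix-sound (S r) a b ab∈))

ContainsCopyAbove : Fin 7 → Rel₀ → Set
ContainsCopyAbove r T = ∃ λ r′ → r < r′ × ∃ λ σ → S r′ ⊆ pullback σ T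

containsCopyAbove : ∀ r {A T} → A ⊆ T → ContainsSuccessor r A → ContainsCopyAbove r T
containsCopyAbove r A⊆T successor with Any.satisfied successor
... | (r′ , σ) , r<r′ , Sr′⊆A = r′ , r<r′ , σ , λ a b ab∈S → A⊆T _ _ (Sr′⊆A a b ab∈S)

climb : ∀ r {T} → Symmetric T → GenNice T → S r ⊆ T → T ⊆ S r ⊎ ContainsCopyAbove r T
climb r {T} T-sym nice Sr⊆T
  with any? (λ i → any? λ j → ((i , j) ∈ₚ? T) ×-dec ¬? ((i , j) ∈ₚ? S r))
... | no none = inj₁ λ i j ij∈T →
  decidable-stable ((i , j) ∈ₚ? S r) λ ij∉S → none (i , j , ij∈T , ij∉S)
... | yes (i , j , ij∈T , ij∉S) = inj₂
  ([ (λ ij∈S → ⊥-elim (ij∉S ij∈S))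
   , containsCopyAbove r (enlarge-sound r (i , j) T-sym nice Sr⊆T ij∈T)
   ]′ (enlarge-containsSuccessor r i j))

-- Each round passes to a pullback, again symmetric and nice, and raises the index, which is bounded
-- in `Fin 7`.
classify : ∀ {r} → Acc _>_ r → ∀ {T} → Symmetric T → GenNice T → S r ⊆ T →
  ∃ λ r′ → ∃ λ σ → pullback σ T ⊆ S r′ × S r′ ⊆ pullback σ T
classify {r} (acc rec) T-sym nice Sr⊆T with climb r T-sym nice Sr⊆T
... | inj₁ T⊆Sr = r , idCollineation , T⊆Sr , Sr⊆T
... | inj₂ (r′ , r<r′ , σ , Sr′⊆)
  with classify (rec r<r′) (λ i j → T-sym _ _) (pullback-GenNice σ nice) Sr′⊆
-- `pullback τ (pullback σ T)` is definitionally `pullback (σ ∘ᶜ τ) T`.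
... | r″ , τ , equal = r″ , σ ∘ᶜ τ , equal

-- From a degenerate violation to `S zero`.

seed : Matrix
seed = foldl insertSym (toMatrix λ _ _ → false) ((# 1 , # 2) ∷ (# 5 , # 1) ∷ [])

opaque
  unfolding moves

  -- Three moves do the work: (1, 5, 1) adds {1, 1} and {0, 5}, then (1, 2, 0) adds {0, 1} and {0,
  -- 2}, and (0, 5, 0) adds {0, 0}.
  S₀⊆saturate-seed : S zero ⊆ entries (saturate moves seed)
  S₀⊆saturate-seed = from-yes (S zero ⊆? entries (saturate moves seed))

S₀⊆ : ∀ {T} → Symmetric T → GenNice T → (# 1 , # 2) ∈ₚ T → (# 5 , # 1) ∈ₚ T → S zero ⊆ T
S₀⊆ T-sym nice 12∈T 51∈T a b ab∈S =
  saturate-sound moves seed T-sym nice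
    (insertAll-sound (toMatrix λ _ _ → false) T-sym (12∈T ∷ 51∈T ∷ [])
      λ i j p → case toMatrix-sound (λ _ _ → false) i j p of λ ())
    a b (S₀⊆saturate-seed a b ab∈S)

*-comm : ∀ i j → i * j ≡ j * i
*-comm = from-yes (all? λ i → all? λ j → i * j ≟ j * i)

X-sym : Symmetric X
X-sym = from-yes (all? λ i → all? λ j → X i j Bool.≟ X j i)

∈-∩X⁻ : ∀ {T} i j → (i , j) ∈ₚ ∩X T → (i , j) ∈ₚ T × (i , j) ∈ₚ X
∈-∩X⁻ {T} i j p = Bool.∧-conicalˡ (T i j) _ p , Bool.∧-conicalʳ (T i j) _ p

PSub-∩X : ∀ {T} i j k → PSub i j k T → PSub i j k X → PSub i j k (∩X T)
PSub-∩X i j k (t₁ , t₂ , t₃ , t₄ , t₅ , t₆) (x₁ , x₂ , x₃ , x₄ , x₅ , x₆) =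
  cong₂ _∧_ t₁ x₁ , cong₂ _∧_ t₂ x₂ , cong₂ _∧_ t₃ x₃ ,
  cong₂ _∧_ t₄ x₄ , cong₂ _∧_ t₅ x₅ , cong₂ _∧_ t₆ x₆

-- A flag is a point `i` on a line; here both pairs of that line containing `i` lie in `T`.
HasFlag : Rel₀ → Set
HasFlag T = ∃ λ i → ∃ λ j → (i , j) ∈ₚ X × (i , j) ∈ₚ T × (i * j , i) ∈ₚ T

hasFlag? : ∀ T → Dec (HasFlag T)
hasFlag? T = any? λ i → any? λ j →
  ((i , j) ∈ₚ? X) ×-dec ((i , j) ∈ₚ? T) ×-dec ((i * j , i) ∈ₚ? T)

-- By `triangle`, a degenerate instance of the rule in X gives a flag at `i` or at `j`; in any other
-- instance the conclusion stays within X.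
flagless⇒GenNice-∩X : ∀ {T} → Symmetric T → GenNice T → ¬ HasFlag T → GenNice (∩X T)
flagless⇒GenNice-∩X {T} T-sym nice none i j k p q =
  let ij∈T , ij∈X = ∈-∩X⁻ {T} i j p
      ijk∈T , ijk∈X = ∈-∩X⁻ {T} (i * j) k q
  in [ (λ k≡i → ⊥-elim (none
         (i , j , ij∈X , ij∈T , subst (λ x → T (i * j) x ≡ true) k≡i ijk∈T)))
     -- The flag at `j`, obtained by exchanging `i` and `j`.
     , [ (λ k≡j → ⊥-elim (none
           (j , i , trans (X-sym j i) ij∈X , trans (T-sym j i) ij∈T
             , subst₂ (λ x y → T x y ≡ true) (*-comm i j) k≡j ijk∈T)))
       , PSub-∩X {T} i j k (nice i j k ij∈T ijk∈T)
       ]′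
     ]′ (triangle i j k ij∈X ijk∈X)

-- The negated hypothesis carries no witness; finite search supplies one.
hasFlag : ∀ {T} → Symmetric T → GenNice T → ¬ GenNice (∩X T) → HasFlag T
hasFlag {T} T-sym nice ¬nice =
  decidable-stable (hasFlag? T) λ none → ¬nice (flagless⇒GenNice-∩X T-sym nice none)

pullback-flag⇒Collinear : ∀ σ T → Symmetric T → GenNice T →
  (# 1 , # 2) ∈ₚ pullback σ T → (# 5 , # 1) ∈ₚ pullback σ T → ∃ λ r → Collinear T (S r)
pullback-flag⇒Collinear σ T T-sym nice 12∈ 51∈ =
  let sym′ : Symmetric (pullback σ T)
      sym′ i j = T-sym (perm σ ⟨$⟩ʳ i) (perm σ ⟨$⟩ʳ j)
      nice′ : GenNice (pullback σ T)
      nice′ = pullback-GenNice σ {T} nice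
      r , τ , pull⊆S , S⊆pull = classify (>-wellFounded zero) {pullback σ T} sym′ nice′
        (S₀⊆ {pullback σ T} sym′ nice′ 12∈ 51∈)
  in r , pullback⇒Collinear (σ ∘ᶜ τ) {T} {S r} T-sym pull⊆S S⊆pull

collinearToListed : ∀ T → Symmetric T → GenNice T → ¬ GenNice (∩X T) → ∃ λ r → Collinear T (S r)
collinearToListed T T-sym nice ¬nice =
  let i , j , ij∈X , ij∈T , iji∈T = hasFlag {T} T-sym nice ¬nice
      k , automorphic = extendToFrame i j ij∈X
  -- `frame i j k` sends 1, 2, 5 to `i`, `j`, `i * j`, so the flag of `T` is definitionally the
  -- required pair of memberships.
  in pullback-flag⇒Collinear (collineation (frame i j k) automorphic) T T-sym nice ij∈T iji∈T

theorem5p8 : (∀ (r : Fin 7) → GenNice (S r) × ¬ GenNice (∩X (S r)))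
    × (∀ (T : Rel₀) → Symmetric T → GenNice T → ¬ GenNice (∩X T) →
    Σ (Fin 7) λ r → Collinear T (S r) × (∀ r′ → Collinear T (S r′) → r′ ≡ r))
theorem5p8 = listed , λ T T-sym nice ¬nice →
  let r , T~Sr = collinearToListed T T-sym nice ¬nice
  in r , T~Sr , λ r′ T~Sr′ → card-S-injective r′ r
       (trans (sym (card-Collinear T-sym T~Sr′)) (card-Collinear T-sym T~Sr))
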